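{- The language $\mathcal{L}(\circ)$ is less expressive than the language $\mathcal{L}(\Box)$ on the class of serial models ($\mathcal{D}$-models), i.e. $\mathcal{L}(\circ)\prec\mathcal{L}(\Box)$ on that class.
   Context: Let $\mathbf{P}$ be a nonempty set of propositional variables. The language $\mathcal{L}(\circ)$ is given by $\phi::=p\mid\neg\phi\mid(\phi\land\phi)\mid\circ\phi$ and the language $\mathcal{L}(\Box)$ by $\phi::=p\mid\neg\phi\mid(\phi\land\phi)\mid\Box\phi$, with $p\in\mathbf{P}$; other Boolean connectives are the usual abbreviations. A model is $\mathcal{M}=\langle S,R,V\rangle$ with $S$ a nonempty set, $R\subseteq S\times S$, and $V:\mathbf{P}\to\mathcal{P}(S)$. Satisfaction at a pointed model $(\mathcal{M},s)$, $s\in S$: $\mathcal{M},s\vDash p$ iff $s\in V(p)$; Booleans as usual; $\mathcal{M},s\vDash\Box\phi$ iff $\mathcal{M},t\vDash\phi$ for all $t$ with $sRt$; $\mathcal{M},s\vDash\circ\phi$ iff ($\mathcal{M},s\vDash\phi$ implies that $\mathcal{M},t\vDash\phi$ for all $t$ with $sRt$). A model is serial if every $s\in S$ has some $t$ with $sRt$. For languages $\mathcal{L}_1,\mathcal{L}_2$ interpreted on the same class $M$ of models: $\mathcal{L}_1\preceq\mathcal{L}_2$ means that for every $\phi\in\mathcal{L}_1$ there is $\psi\in\mathcal{L}_2$ such that $\mathcal{M},s\vDash\phi$ iff $\mathcal{M},s\vDash\psi$ for all pointed models $(\mathcal{M},s)$ with $\mathcal{M}\in M$. $\mathcal{L}_1$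 is less expressive than $\mathcal{L}_2$, written $\mathcal{L}_1\prec\mathcal{L}_2$, if $\mathcal{L}_1\preceq\mathcal{L}_2$ and $\mathcal{L}_2\not\preceq\mathcal{L}_1$. -}

module Defs where

open import Level using (Level; suc; _⊔_)
open import Data.Product using (_×_; Σ-syntax; ∃-syntax)
open import Function.Bundles using (_⇔_)
open import Relation.Binary.Core using (Rel)
open import Relation.Nullary using (¬_)
open import Relation.Unary using (Pred; _∈_)

private
  variable
    a b c ℓ m : Level

record Model (𝐏 : Set a) (ℓ : Level) : Set (a ⊔ suc ℓ) where
  field
    State    : Set ℓ
    nonempty : State
    R        : Rel State ℓ
    V        : 𝐏 → Pred State ℓ

open Model public using (State)

Serial : {𝐏 : Set a} → Pred (Model 𝐏 ℓ) ℓ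
Serial M = ∀ s → ∃[ t ] R s t
  where open Model M

infixr 6 _∧_
infix  7 ~_ ∘_ □_

data Form∘ (𝐏 : Set a) : Set a where
  var : 𝐏 → Form∘ 𝐏
  ~_  : Form∘ 𝐏 → Form∘ 𝐏
  _∧_ : Form∘ 𝐏 → Form∘ 𝐏 → Form∘ 𝐏
  ∘_  : Form∘ 𝐏 → Form∘ 𝐏

data Form□ (𝐏 : Set a) : Set a where
  var : 𝐏 → Form□ 𝐏
  ~_  : Form□ 𝐏 → Form□ 𝐏
  _∧_ : Form□ 𝐏 → Form□ 𝐏 → Form□ 𝐏
  □_  : Form□ 𝐏 → Form□ 𝐏

module _ {𝐏 : Set a} (M : Model 𝐏 ℓ) where
  open Model M using (R; V)

  infix 4 _⊨∘_ _⊨□_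

  _⊨∘_ : State M → Form∘ 𝐏 → Set ℓ
  s ⊨∘ var p = s ∈ V p
  s ⊨∘ ~ φ   = ¬ (s ⊨∘ φ)
  s ⊨∘ φ ∧ ψ = s ⊨∘ φ × s ⊨∘ ψ
  s ⊨∘ ∘ φ   = s ⊨∘ φ → ∀ t → R s t → t ⊨∘ φ

  _⊨□_ : State M → Form□ 𝐏 → Set ℓ
  s ⊨□ var p = s ∈ V p
  s ⊨□ ~ φ   = ¬ (s ⊨□ φ)
  s ⊨□ φ ∧ ψ = s ⊨□ φ × s ⊨□ ψ
  s ⊨□ □ φ   = ∀ t → R s t → t ⊨□ φ

record Language (𝐏 : Set a) (ℓ b : Level) : Set (a ⊔ suc (ℓ ⊔ b)) where
  field
    Formula : Set b
    Sat     : (M : Model 𝐏 ℓ) → State M → Formula → Set ℓ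

𝓛∘ : (𝐏 : Set a) (ℓ : Level) → Language 𝐏 ℓ a
𝓛∘ 𝐏 ℓ = record { Formula = Form∘ 𝐏 ; Sat = _⊨∘_ }

𝓛□ : (𝐏 : Set a) (ℓ : Level) → Language 𝐏 ℓ a
𝓛□ 𝐏 ℓ = record { Formula = Form□ 𝐏 ; Sat = _⊨□_ }

module _ {𝐏 : Set a} where

  infix 4 _≼_on_ _≺_on_

  _≼_on_ : Language 𝐏 ℓ b → Language 𝐏 ℓ c → Pred (Model 𝐏 ℓ) m →
           Set (a ⊔ suc ℓ ⊔ b ⊔ c ⊔ m)
  L₁ ≼ L₂ on C =
    ∀ (φ : L₁.Formula) → Σ[ ψ ∈ L₂.Formula ]
      (∀ M → M ∈ C → ∀ s → L₁.Sat M s φ ⇔ L₂.Sat M s ψ)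
    where
    module L₁ = Language L₁
    module L₂ = Language L₂

  _≺_on_ : Language 𝐏 ℓ b → Language 𝐏 ℓ c → Pred (Model 𝐏 ℓ) m →
           Set (a ⊔ suc ℓ ⊔ b ⊔ c ⊔ m)
  L₁ ≺ L₂ on C = L₁ ≼ L₂ on C × ¬ (L₂ ≼ L₁ on C)

-- Classically ∘φ is ¬(φ ∧ ¬□φ).  Conversely, ∘ cannot see whether a state is its own
-- successor, since the premise of φ → □φ already settles that case; □ can.  So the two-state
-- cycle p̄ ⇄ p and its reflexive closure, both serial, agree on 𝓛(∘), but □p holds at p̄ only
-- in the former.

{-# OPTIONS --safe #-}
module Submission where

open import Defs
open import Axiom.ExcludedMiddle using (ExcludedMiddle)
open import Data.Bool.Base using (Bool; false; not; T)
open import Data.Product using (_,_; -,_; proj₁; proj₂)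
open import Data.Product.Function.NonDependent.Propositional using (_×-⇔_)
open import Data.Unit.Base using (tt)
open import Function.Bundles using (_⇔_; mk⇔; Equivalence)
open import Function.Construct.Identity using (⇔-id)
open import Function.Related.TypeIsomorphisms using (¬-cong-⇔)
open import Level using (Level; Lift; lift; lower)
open import Relation.Binary.Construct.Closure.Reflexive using (ReflClosure; refl; [_])
open import Relation.Binary.PropositionalEquality as ≡ using (_≡_)
open import Relation.Nullary using (¬_)
open import Relation.Nullary.Decidable using (decidable-stable)

private
  variable
    a ℓ : Level
    𝐏 : Set a

open Equivalence using (to; from)

∘⇒□ : Form∘ 𝐏 → Form□ 𝐏
∘⇒□ (var p) = var p
∘⇒□ (~ φ)   = ~ ∘⇒□ φ
∘⇒□ (φ ∧ ψ) = ∘⇒□ φ ∧ ∘⇒□ ψ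
∘⇒□ (∘ φ)   = ~ (∘⇒□ φ ∧ ~ □ ∘⇒□ φ)

∘⇒□-correct : ExcludedMiddle ℓ → (M : Model 𝐏 ℓ) → ∀ φ s →
              _⊨∘_ M s φ ⇔ _⊨□_ M s (∘⇒□ φ)
∘⇒□-correct em M (var p) s = ⇔-id _
∘⇒□-correct em M (~ φ)   s = ¬-cong-⇔ (∘⇒□-correct em M φ s)
∘⇒□-correct em M (φ ∧ ψ) s = ∘⇒□-correct em M φ s ×-⇔ ∘⇒□-correct em M ψ s
∘⇒□-correct em M (∘ φ)   s = mk⇔
  (λ h (sφ , ¬□φ) → ¬□φ λ t sRt → to (ih t) (h (from (ih s) sφ) t sRt))
  (λ h sφ t sRt → from (ih t)
    -- Excluded middle enters only here: `h` and `sφ` refute `¬□φ`, which constructively gives just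
    -- the double negation of `□φ`.
    (decidable-stable em (λ ¬□φ → h (to (ih s) sφ , ¬□φ)) t sRt))
  where ih = ∘⇒□-correct em M φ

reflexiveClosure : Model 𝐏 ℓ → Model 𝐏 ℓ
reflexiveClosure M = record { Model M hiding (R) ; R = ReflClosure (Model.R M) }

reflexiveClosure-serial : (M : Model 𝐏 ℓ) → Serial M → Serial (reflexiveClosure M)
reflexiveClosure-serial M serial s = -, [ proj₂ (serial s) ]

-- Induction on `φ` for all states at once, in both directions: under `∘` the premise is carried
-- back to the other model and the conclusion forward.
⊨∘-reflexiveClosure : (M : Model 𝐏 ℓ) → ∀ φ s →
                      _⊨∘_ M s φ ⇔ _⊨∘_ (reflexiveClosure M) s φ
⊨∘-reflexiveClosure M (var p) s = ⇔-id _
⊨∘-reflexiveClosure M (~ φ)   s = ¬-cong-⇔ (⊨∘-reflexiveClosure M φ s)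
⊨∘-reflexiveClosure M (φ ∧ ψ) s = ⊨∘-reflexiveClosure M φ s ×-⇔ ⊨∘-reflexiveClosure M ψ s
⊨∘-reflexiveClosure M (∘ φ)   s = mk⇔
  -- An added loop demands `φ` at `s` itself, which is `sφ`.
  (λ { h sφ t refl    → sφ
     ; h sφ t [ sRt ] → to (ih t) (h (from (ih s) sφ) t sRt) })
  (λ h sφ t sRt → from (ih t) (h (to (ih s) sφ) t [ sRt ]))
  where ih = ⊨∘-reflexiveClosure M φ

-- `V` ignores the variable, so any element of `𝐏` can serve as `p`.
twoCycle : (𝐏 : Set a) (ℓ : Level) → Model 𝐏 ℓ
twoCycle 𝐏 ℓ = record
  { State    = Lift ℓ Bool
  ; nonempty = lift false
  ; R        = λ s t → t ≡ lift (not (lower s))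
  ; V        = λ _ s → Lift ℓ (T (lower s))
  }

twoCycle-serial : (𝐏 : Set a) (ℓ : Level) → Serial (twoCycle 𝐏 ℓ)
twoCycle-serial 𝐏 ℓ s = -, ≡.refl

□⋠∘ : 𝐏 → ¬ (𝓛□ 𝐏 ℓ ≼ 𝓛∘ 𝐏 ℓ on Serial)
-- The loop at `p̄` would force `p` there, that is, `T false`.
□⋠∘ {𝐏 = 𝐏} {ℓ = ℓ} p □≼∘ = lower (□p-closure p̄ refl)
  where
  C = twoCycle 𝐏 ℓ
  C-serial = twoCycle-serial 𝐏 ℓ
  C⁼ = reflexiveClosure C
  p̄ = lift false
  -- `ψ` is fixed before any model is chosen, so it can be compared across `C` and `C⁼`.
  ψ = proj₁ (□≼∘ (□ var p))
  □p⇔ψ = proj₂ (□≼∘ (□ var p))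

  □p : _⊨□_ C p̄ (□ var p)
  -- The only successor of `p̄` in `C` is `lift (not false)`.
  □p _ ≡.refl = lift tt

  □p-closure : _⊨□_ C⁼ p̄ (□ var p)
  □p-closure =
    from (□p⇔ψ C⁼ (reflexiveClosure-serial C C-serial) p̄)
      (to (⊨∘-reflexiveClosure C ψ p̄)
        (to (□p⇔ψ C C-serial p̄) □p))

proposition7 : ∀ {a ℓ} → ExcludedMiddle ℓ → (𝐏 : Set a) → 𝐏 →
    𝓛∘ 𝐏 ℓ ≺ 𝓛□ 𝐏 ℓ on Serial
proposition7 em 𝐏 p = (λ φ → ∘⇒□ φ , λ M _ → ∘⇒□-correct em M φ) , □⋠∘ p
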